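{- For $\Delta=4$ and $k=0$ there is a gadget, i.e. a realizable instance of $4$-$0$-DiTTR, that enforces $\lambda(v_1,v_2)=\lambda(v_2,v_1)$ for some pair of adjacent vertices $(v_1,v_2)$.
   Context: All graphs are finite. A $\Delta$-periodic labeling of a directed graph $G=(V,E)$ is a map $\lambda:E\to\{0,1,\dots,\Delta-1\}$; edge $e$ is then active exactly at the times $\lambda(e)+i\Delta$, $i\in\mathbb{N}_0$. A temporal $s$-$z$-path is a sequence $(v_{i-1},v_i,t_i)_{i=1}^{\ell}$ with $v_0=s$, $v_\ell=z$, pairwise distinct vertices $v_0,\dots,v_\ell$, $(v_{i-1},v_i)\in E$ active at time $t_i$ for every $i$, and $t_1<t_2<\dots<t_\ell$ (strictly increasing). Its duration is $t_\ell+1-t_1$. A fastest temporal path is one of minimum duration. $\hat d(u,v)$ is the distance from $u$ to $v$ in the static graph $G$ (all edges have unit length). A bidirected tree is the directed graph obtained from an undirected tree by replacing each edge $\{u,v\}$ by the two directed edges $(u,v),(v,u)$ (which may get different labels). For integers $\Delta\ge1,k\ge0$, an instance of $\Delta$-$k$-DiTTR consists of a bidirected tree $G=(V,E)$ and a matrix $D$ indexed by $V\times V$ with entries positive integers or $\infty$ (no restriction) such that $D_{u,v}\ge\hat d(u,v)+k$ for all $u,v$. A valid labeling is a $\Delta$-periodic labeling $\lambda$ of $E$ such that, for all $u,v\in V$, the duration of a fastest temporal path from $u$ to $v$ is at most $D_{u,v}$; the instance is realizable if a valid labeling exists. Diagonal entries of $D$ play no role; all conditions on $D$ are for distinct vertices.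 An instance enforces $\lambda(v_1,v_2)=\lambda(v_2,v_1)$ if this equality holds for every valid labeling $\lambda$. -}

module Defs where

open import Data.Bool using (Bool; T)
open import Data.Fin using (Fin; toℕ)
open import Data.List using (List; []; _∷_; foldl)
open import Data.List.Relation.Unary.Linked using (Linked)
open import Data.List.Relation.Unary.Unique.Propositional using (Unique)
open import Data.Nat using (ℕ; zero; suc; _+_; _*_; _∸_; _≤_; _<_; NonZero)
open import Data.Product using (Σ-syntax; ∃-syntax; _×_; proj₁)
open import Level using (0ℓ)
open import Relation.Binary using (Rel; Symmetric)
open import Relation.Binary.Construct.Closure.ReflexiveTransitive using (Star; ε; _◅_)
open import Relation.Binary.Construct.Add.Supremum.NonStrict {A = ℕ} _≤_ using (_≤⁺_)
open import Relation.Binary.PropositionalEquality using (_≡_; _≢_)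
open import Relation.Nullary using (¬_)
open import Relation.Nullary.Construct.Add.Supremum using (_⁺; [_])

module _ {A : Set} {R : Rel A 0ℓ} where

  length : ∀ {u v} → Star R u v → ℕ
  length ε       = zero
  length (_ ◅ w) = suc (length w)

  vertices : ∀ {u v} → Star R u v → List A
  vertices {u} ε       = u ∷ []
  vertices {u} (_ ◅ w) = u ∷ vertices w

Path : {A : Set} → Rel A 0ℓ → Rel A 0ℓ
Path R u v = Σ[ w ∈ Star R u v ] Unique (vertices w)

IsDistance : {A : Set} → Rel A 0ℓ → A → A → ℕ → Set
IsDistance R u v d =
  (Σ[ p ∈ Path R u v ] length (proj₁ p) ≡ d) ×
  (∀ (p : Path R u v) → d ≤ length (proj₁ p))

record Digraph : Set where
  field
    order : ℕ
    arc   : Fin order → Fin order → Bool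

  Vertex : Set
  Vertex = Fin order

  -- T (arc u v) has at most one element, so a function on Arc u v assigns at
  -- most one value to the directed edge (u , v).
  Arc : Rel Vertex 0ℓ
  Arc u v = T (arc u v)

record Graph : Set where
  field
    order : ℕ
    adj   : Fin order → Fin order → Bool

  Vertex : Set
  Vertex = Fin order

  Adj : Rel Vertex 0ℓ
  Adj u v = T (adj u v)

  field
    adj-sym    : Symmetric Adj
    adj-irrefl : ∀ v → ¬ Adj v v

record IsTree (G : Graph) : Set where
  open Graph G
  field
    nonEmpty  : NonZero order
    connected : ∀ u v → Star Adj u v
    -- A cycle is a path with at least two edges together with an edge joining
    -- its ends.
    acyclic   : ∀ u v (p : Path Adj u v) → 2 ≤ length (proj₁ p) → ¬ Adj v u

bidirect : Graph → Digraph
bidirect G = record { order = Graph.order G ; arc = Graph.adj G }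

module _ (G : Digraph) (Δ : ℕ) where
  open Digraph G

  Labeling : Set
  Labeling = ∀ u v → Arc u v → Fin Δ

module _ {G : Digraph} {Δ : ℕ} (ℓ : Labeling G Δ) where
  open Digraph G

  Active : ∀ u v → Arc u v → ℕ → Set
  Active u v e t = ∃[ i ] t ≡ toℕ (ℓ u v e) + i * Δ

  record TimedArc (u v : Vertex) : Set where
    field
      edge   : Arc u v
      time   : ℕ
      active : Active u v edge time

  times : ∀ {u v} → Star TimedArc u v → List ℕ
  times ε       = []
  times (a ◅ w) = TimedArc.time a ∷ times w

  record TemporalPath (s z : Vertex) : Set where
    field
      steps      : Star TimedArc s z
      distinct   : Unique (vertices steps)
      increasing : Linked _<_ (times steps)

  -- The value at [] is a junk value, reached only when the two ends coincide.
  -- The fold picks out the last time.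
  timeSpan : List ℕ → ℕ
  timeSpan []       = 0
  timeSpan (t ∷ ts) = suc (foldl (λ _ t′ → t′) t ts) ∸ t

  duration : ∀ {s z} → TemporalPath s z → ℕ
  duration P = timeSpan (times (TemporalPath.steps P))

  IsFastest : ∀ {s z} → TemporalPath s z → Set
  IsFastest {s} {z} P = ∀ (Q : TemporalPath s z) → duration P ≤ duration Q

record DiTTR (Δ k : ℕ) .{{_ : NonZero Δ}} : Set where
  field
    tree   : Graph
    isTree : IsTree tree

  open Graph tree public using (Vertex; Adj; adj-sym)

  digraph : Digraph
  digraph = bidirect tree

  open Digraph digraph public using (Arc)

  field
    D          : Vertex → Vertex → ℕ ⁺
    D-positive : ∀ u v → [ 1 ] ≤⁺ D u v
    D-distance : ∀ u v → u ≢ v → ∀ d → IsDistance Arc u v d → [ d + k ] ≤⁺ D u v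

module _ {Δ k : ℕ} .{{_ : NonZero Δ}} (I : DiTTR Δ k) where
  open DiTTR I

  -- An entry ∞ of D imposes no condition.
  Valid : Labeling digraph Δ → Set
  Valid ℓ = ∀ u v → u ≢ v → ∀ d → D u v ≡ [ d ] →
    Σ[ P ∈ TemporalPath ℓ u v ] (IsFastest ℓ P × duration ℓ P ≤ d)

  Realizable : Set
  Realizable = Σ[ ℓ ∈ Labeling digraph Δ ] Valid ℓ

  EnforcesEqual : (v₁ v₂ : Vertex) → Adj v₁ v₂ → Set
  EnforcesEqual v₁ v₂ e =
    ∀ (ℓ : Labeling digraph Δ) → Valid ℓ → ℓ v₁ v₂ e ≡ ℓ v₂ v₁ (adj-sym e)

{-# OPTIONS --safe #-}
-- The tree is the edge 01 with two leaves 2, 3 attached to 1 and two leaves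
-- 4, 5 attached to 0.  Write p, q for the labels of (0,1), (1,0).  The bounds
-- 2, 2, 3 for the pairs (0,2), (3,0), (3,2) force λ(1,2) = p + 1,
-- q = λ(3,1) + 1 and λ(1,2) - λ(3,1) ∈ {1, 2} modulo 4, so q - p ∈ {0, 1}.
-- The mirror-image bounds at 0 give p - q ∈ {0, 1}, whence p = q.
module Submission where

open import Defs
open import Data.Bool using (Bool; true; false; _∨_; T; T?)
open import Data.Bool.Properties using (∨-comm; T-irrelevant)
open import Data.Fin using (Fin; toℕ; _<_; _≤_)
open import Data.Fin.Patterns using (0F; 1F; 2F; 3F; 4F; 5F)
open import Data.Fin.Properties using (all?; any?; _≟_; _<?_; <-cmp; <-trans; ≤-refl; toℕ<n)
open import Data.List using ([]; _∷_)
open import Data.List.Membership.Propositional using (_∈_)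
open import Data.List.Relation.Unary.All as All using (All; []; _∷_)
open import Data.List.Relation.Unary.All.Properties using (¬Any⇒All¬)
open import Data.List.Relation.Unary.AllPairs using ([]; _∷_)
open import Data.List.Relation.Unary.Any using (here; there) renaming (any? to anyList?)
open import Data.List.Relation.Unary.Linked using (Linked; [-]; _∷_)
open import Data.List.Relation.Unary.Unique.Propositional using (Unique)
open import Data.Nat as ℕ using (ℕ; suc; _+_; _*_; _∸_; _%_; _/_; z≤n; s≤s; NonZero; nonZero)
open import Data.Nat.DivMod using (m≡m%n+[m/n]*n; [m+kn]%n≡m%n; m<n⇒m%n≡m)
import Data.Nat.Properties as ℕ
open import Data.Product using (Σ-syntax; ∃-syntax; _×_; _,_; proj₁; proj₂)
open import Data.Sum using (_⊎_)
open import Data.Unit using (⊤; tt)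
open import Level using (0ℓ)
open import Relation.Binary using (Rel; tri<; tri≈; tri>)
open import Relation.Binary.Construct.Add.Supremum.NonStrict {A = ℕ} ℕ._≤_ using (_≤⁺_; [_]; _≤⊤⁺)
open import Relation.Binary.Construct.Closure.ReflexiveTransitive using (Star; ε; _◅_; _◅◅_; gmap; reverse)
open import Relation.Binary.PropositionalEquality using (_≡_; _≢_; refl; sym; trans; cong; subst; subst₂; module ≡-Reasoning)
open import Relation.Nullary using (¬_; Dec; yes; no; contradiction)
open import Relation.Nullary.Construct.Add.Supremum using (_⁺; ⊤⁺; [_])
open import Relation.Nullary.Decidable using (from-yes; _×-dec_; _⊎-dec_; _→-dec_; ¬?)

module _ {A : Set} {R : Rel A 0ℓ} where

  start∈ : ∀ {u v} (w : Star R u v) → u ∈ vertices w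
  start∈ ε       = here refl
  start∈ (_ ◅ _) = here refl

  end∈ : ∀ {u v} (w : Star R u v) → v ∈ vertices w
  end∈ ε       = here refl
  end∈ (_ ◅ w) = there (end∈ w)

  vertices-map : {S : Rel A 0ℓ} (f : ∀ {u v} → R u v → S u v) →
    ∀ {u v} (w : Star R u v) → vertices (gmap (λ x → x) f w) ≡ vertices w
  vertices-map f ε           = refl
  vertices-map f {u} (_ ◅ w) = cong (u ∷_) (vertices-map f w)

  All-prefix : ∀ {P : A → Set} {u v z} (w₁ : Star R u v) (w₂ : Star R v z) →
    All P (vertices (w₁ ◅◅ w₂)) → All P (vertices w₁)
  All-prefix ε        w₂ ps       = All.lookup ps (start∈ w₂) ∷ []
  All-prefix (_ ◅ w₁) w₂ (p ∷ ps) = p ∷ All-prefix w₁ w₂ ps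

  split : ∀ {u m z} (w : Star R u z) → Unique (vertices w) → m ∈ vertices w →
    Σ[ w₁ ∈ Star R u m ] Σ[ w₂ ∈ Star R m z ]
      w ≡ w₁ ◅◅ w₂ × Unique (vertices w₁) × Unique (vertices w₂)
  split ε       !w       (here refl) = ε , ε , refl , [] ∷ [] , !w
  split (a ◅ w) !w       (here refl) = ε , a ◅ w , refl , [] ∷ [] , !w
  split (a ◅ w) (u∉ ∷ !w) (there m∈) with split w !w m∈
  ... | w₁ , w₂ , refl , !w₁ , !w₂ =
    a ◅ w₁ , w₂ , refl , All-prefix w₁ w₂ u∉ ∷ !w₁ , !w₂

-- A cycle would have a largest vertex, with two smaller neighbours.
module SmallerNeighbour (G : Graph)
  (smaller-unique : ∀ {x x′ y} → Graph.Adj G x y → Graph.Adj G x′ y → x < y → x′ < y → x ≡ x′)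
  where
  open Graph G

  climb : ∀ {x y z} (a : Adj x y) (w : Star Adj y z) → Unique (vertices (a ◅ w)) → x < y → y ≤ z
  climb a ε       _ _   = ≤-refl
  climb {x} {y} a (_◅_ {_} {y′} b w) ((_ ∷ x∉) ∷ !w) x<y with <-cmp y y′
  ... | tri< y<y′ _ _ = ℕ.≤-trans (ℕ.<⇒≤ y<y′) (climb b w !w y<y′)
  ... | tri≈ _ refl _ = contradiction b (adj-irrefl y)
  ... | tri> _ _ y′<y =
    contradiction (smaller-unique a (adj-sym b) x<y y′<y) (All.lookup x∉ (start∈ w))

  last-smaller : ∀ {y z} (w : Star Adj y z) → Unique (vertices w) → y < z →
    ∃[ p ] p ∈ vertices w × Adj p z × p < z
  last-smaller ε _ z<z = contradiction z<z (ℕ.<-irrefl refl)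
  last-smaller {y} {z} (_◅_ {_} {y′} a w) !aw@(_ ∷ !w) y<z with <-cmp y′ z
  ... | tri< y′<z _ _ = let p , p∈ , rest = last-smaller w !w y′<z in p , there p∈ , rest
  ... | tri≈ _ refl _ = y , here refl , a , y<z
  ... | tri> _ _ z<y′ =
    contradiction (climb a w !aw (<-trans y<z z<y′)) (ℕ.<⇒≱ z<y′)

  acyclic : ∀ u v (p : Path Adj u v) → 2 ℕ.≤ length (proj₁ p) → ¬ Adj v u
  acyclic u v (a ◅ ε , _) (s≤s ()) _
  acyclic u v (_◅_ {_} {y} a (b ◅ w) , !p@(u∉ ∷ !w@(y∉ ∷ _))) _ c with <-cmp u v
  ... | tri≈ _ refl _ = adj-irrefl v c
  ... | tri> _ _ v<u with <-cmp u y
  ...   | tri< u<y _ _ = ℕ.<⇒≱ (<-trans v<u u<y) (climb a (b ◅ w) !p u<y)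
  ...   | tri≈ _ refl _ = adj-irrefl u a
  ...   | tri> _ _ y<u = All.lookup y∉ (end∈ w) (smaller-unique (adj-sym a) c y<u v<u)
  acyclic u v (_◅_ {_} {y} a (b ◅ w) , !p@(u∉ ∷ !w@(y∉ ∷ _))) _ c | tri< u<v _ _ with <-cmp y v
  ... | tri≈ _ refl _ = All.lookup y∉ (end∈ w) refl
  ... | tri> _ _ v<y = ℕ.<⇒≱ v<y (climb a (b ◅ w) !p (<-trans u<v v<y))
  ... | tri< y<v _ _ =
    let p , p∈ , p~v , p<v = last-smaller (b ◅ w) !w y<v
    in All.lookup u∉ p∈ (smaller-unique (adj-sym c) p~v u<v p<v)

module TreePaths (G : Graph) (isTree : IsTree G) where
  open Graph G
  open IsTree isTree

  adjacent-path : ∀ {u v} → Adj u v → (w : Star Adj u v) → Unique (vertices w) →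
    vertices w ≡ u ∷ v ∷ []
  adjacent-path e ε           !w = contradiction e (adj-irrefl _)
  adjacent-path e (a ◅ ε)     !w = refl
  adjacent-path e (a ◅ b ◅ w) !w =
    contradiction (adj-sym e) (acyclic _ _ (a ◅ b ◅ w , !w) (s≤s (s≤s z≤n)))

  two-step-path : ∀ {u m z} → u ≢ z → Adj u m → Adj m z → (w : Star Adj u z) →
    Unique (vertices w) → vertices w ≡ u ∷ m ∷ z ∷ []
  two-step-path {u} {m} {z} u≢z e f w !w with anyList? (m ≟_) (vertices w)
  ... | yes m∈ with split w !w m∈
  ...   | w₁ , w₂ , refl , !w₁ , !w₂ = glue w₁ w₂ (adjacent-path e w₁ !w₁) (adjacent-path f w₂ !w₂)
    where
    glue : ∀ (w₁ : Star Adj u m) (w₂ : Star Adj m z) → vertices w₁ ≡ u ∷ m ∷ [] →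
      vertices w₂ ≡ m ∷ z ∷ [] → vertices (w₁ ◅◅ w₂) ≡ u ∷ m ∷ z ∷ []
    glue (a ◅ ε)         w₂ eq₁ eq₂ = cong (u ∷_) eq₂
    glue (a ◅ b ◅ ε)     w₂ ()
    glue (a ◅ b ◅ c ◅ w) w₂ ()
  two-step-path {u} {m} {z} u≢z e f ε       !w | no m∉ = contradiction refl u≢z
  two-step-path {u} {m} {z} u≢z e f (a ◅ w) !w | no m∉ =
    contradiction (adj-sym f)
      (acyclic _ _ (adj-sym e ◅ a ◅ w , ¬Any⇒All¬ _ m∉ ∷ !w) (s≤s (s≤s z≤n)))

Follows : {Δ : ℕ} .{{_ : NonZero Δ}} → ℕ → Fin Δ → Fin Δ → Set
Follows {Δ} δ i j = (toℕ i + δ) % Δ ≡ toℕ j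

follows? : ∀ {Δ} .{{_ : NonZero Δ}} δ (i j : Fin Δ) → Dec (Follows δ i j)
follows? {Δ} δ i j = (toℕ i + δ) % Δ ℕ.≟ toℕ j

module TwoStep {Δ k : ℕ} .{{_ : NonZero Δ}} (I : DiTTR Δ k) (ℓ : Labeling (DiTTR.digraph I) Δ) where
  open DiTTR I
  open Graph tree using (adj-irrefl)
  open TreePaths tree isTree

  active-follows : ∀ {i j : Fin Δ} {s t δ a b} → s ≡ toℕ i + a * Δ → t ≡ toℕ j + b * Δ →
    s + δ ≡ t → Follows δ i j
  active-follows {i} {j} {δ = δ} {a} {b} refl refl eq = begin
    (toℕ i + δ) % Δ           ≡⟨ [m+kn]%n≡m%n (toℕ i + δ) a Δ ⟨
    (toℕ i + δ + a * Δ) % Δ   ≡⟨ cong (_% Δ) (ℕ.+-assoc (toℕ i) δ _) ⟩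
    (toℕ i + (δ + a * Δ)) % Δ ≡⟨ cong (λ n → (toℕ i + n) % Δ) (ℕ.+-comm δ _) ⟩
    (toℕ i + (a * Δ + δ)) % Δ ≡⟨ cong (_% Δ) (ℕ.+-assoc (toℕ i) _ δ) ⟨
    (toℕ i + a * Δ + δ) % Δ   ≡⟨ cong (_% Δ) eq ⟩
    (toℕ j + b * Δ) % Δ       ≡⟨ [m+kn]%n≡m%n (toℕ j) b Δ ⟩
    toℕ j % Δ                 ≡⟨ m<n⇒m%n≡m (toℕ<n j) ⟩
    toℕ j                     ∎
    where open ≡-Reasoning

  two-step-duration : ∀ {u m z} → u ≢ z → (e : Adj u m) (f : Adj m z) (P : TemporalPath ℓ u z) →
    ∃[ δ ] 1 ℕ.≤ δ × duration ℓ P ≡ suc δ × Follows δ (ℓ u m e) (ℓ m z f)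
  two-step-duration {u} {m} {z} u≢z e f record { steps = w ; distinct = !w ; increasing = incr } =
    shape w incr (trans (sym vs≡) (two-step-path u≢z e f w′ (subst Unique (sym vs≡) !w)))
    where
    w′ = gmap (λ x → x) TimedArc.edge w

    vs≡ : vertices w′ ≡ vertices w
    vs≡ = vertices-map TimedArc.edge w

    shape : (w : Star (TimedArc ℓ) u z) → Linked ℕ._<_ (times ℓ w) → vertices w ≡ u ∷ m ∷ z ∷ [] →
      ∃[ δ ] 1 ℕ.≤ δ × timeSpan ℓ (times ℓ w) ≡ suc δ × Follows δ (ℓ u m e) (ℓ m z f)
    shape ε                   _ ()
    shape (a ◅ ε)             _ ()
    shape (a ◅ b ◅ c ◅ ε)     _ ()
    shape (a ◅ b ◅ c ◅ d ◅ w) _ ()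
    shape (a ◅ b ◅ ε) (s<t ∷ [-]) refl
      rewrite T-irrelevant e (TimedArc.edge a) | T-irrelevant f (TimedArc.edge b) =
      t ∸ s , ℕ.m<n⇒0<n∸m s<t , ℕ.+-∸-assoc 1 (ℕ.<⇒≤ s<t) ,
      active-follows {a = proj₁ (TimedArc.active a)} {b = proj₁ (TimedArc.active b)}
        (proj₂ (TimedArc.active a)) (proj₂ (TimedArc.active b)) (ℕ.m+[n∸m]≡n (ℕ.<⇒≤ s<t))
      where
      s = TimedArc.time a
      t = TimedArc.time b

  bounded-delay : Valid I ℓ → ∀ {u m z c} → u ≢ z → (e : Adj u m) (f : Adj m z) →
    D u z ≡ [ suc c ] → ∃[ δ ] 1 ℕ.≤ δ × δ ℕ.≤ c × Follows δ (ℓ u m e) (ℓ m z f)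
  bounded-delay valid u≢z e f D≡ =
    let P , _ , P≤ = valid _ _ u≢z _ D≡
        δ , 1≤δ , P≡ , follows = two-step-duration u≢z e f P
    in δ , 1≤δ , ℕ.≤-pred (subst (ℕ._≤ _) P≡ P≤) , follows

  exact-delay : Valid I ℓ → ∀ {u m z} → u ≢ z → (e : Adj u m) (f : Adj m z) →
    D u z ≡ [ 2 ] → Follows 1 (ℓ u m e) (ℓ m z f)
  exact-delay valid u≢z e f D≡ with bounded-delay valid u≢z e f D≡
  ... | _ , s≤s z≤n , s≤s z≤n , follows = follows

  follows-path : ∀ {u m z δ} → u ≢ z → (e : Adj u m) (f : Adj m z) → 1 ℕ.≤ δ →
    Follows δ (ℓ u m e) (ℓ m z f) → Σ[ P ∈ TemporalPath ℓ u z ] duration ℓ P ≡ suc δ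
  follows-path {u} {m} {z} {δ} u≢z e f 1≤δ follows = record
    { steps = a ◅ b ◅ ε
    ; distinct = ((λ { refl → adj-irrefl _ e }) ∷ u≢z ∷ []) ∷ ((λ { refl → adj-irrefl _ f }) ∷ []) ∷ [] ∷ []
    ; increasing = s<t ∷ [-]
    } , trans (ℕ.+-∸-assoc 1 (ℕ.<⇒≤ s<t)) (cong suc (ℕ.m+n∸m≡n s δ))
    where
    s = toℕ (ℓ u m e)
    s<t : s ℕ.< s + δ
    s<t = ℕ.m<m+n s 1≤δ
    a : TimedArc ℓ u m
    a = record { edge = e ; time = s ; active = 0 , sym (ℕ.+-identityʳ s) }
    b : TimedArc ℓ m z
    b = record { edge = f ; time = s + δ ; active = (s + δ) / Δ ,
      trans (m≡m%n+[m/n]*n (s + δ) Δ) (cong (_+ (s + δ) / Δ * Δ) follows) }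

edge : Fin 6 → Fin 6 → Bool
edge 0F 1F = true
edge 1F 2F = true
edge 1F 3F = true
edge 0F 4F = true
edge 0F 5F = true
edge _  _  = false

doubleStar : Graph
doubleStar = record
  { order      = 6
  ; adj        = λ u v → edge u v ∨ edge v u
  ; adj-sym    = λ {u} {v} → subst T (∨-comm (edge u v) (edge v u))
  ; adj-irrefl = from-yes (all? λ v → ¬? (T? (edge v v ∨ edge v v)))
  }

open Graph doubleStar using (Adj; adj; adj-sym; adj-irrefl)

doubleStar-smaller-unique : ∀ {x x′ y} → Adj x y → Adj x′ y → x < y → x′ < y → x ≡ x′
doubleStar-smaller-unique {x} {x′} {y} = from-yes
  (all? λ x → all? λ x′ → all? λ y →
    T? (adj x y) →-dec T? (adj x′ y) →-dec x <? y →-dec x′ <? y →-dec x ≟ x′) x x′ y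

to-centre : ∀ v → Star Adj v 0F
to-centre 0F = ε
to-centre 1F = _ ◅ ε
to-centre 2F = _◅_ {j = 1F} _ (_ ◅ ε)
to-centre 3F = _◅_ {j = 1F} _ (_ ◅ ε)
to-centre 4F = _ ◅ ε
to-centre 5F = _ ◅ ε

doubleStar-isTree : IsTree doubleStar
doubleStar-isTree = record
  { nonEmpty  = nonZero
  ; connected = λ u v → to-centre u ◅◅ reverse (λ {x} {y} → adj-sym {x} {y}) (to-centre v)
  ; acyclic   = SmallerNeighbour.acyclic doubleStar
      λ {x} {x′} {y} → doubleStar-smaller-unique {x} {x′} {y}
  }

bound : Fin 6 → Fin 6 → ℕ ⁺
bound 0F 2F = [ 2 ]
bound 3F 0F = [ 2 ]
bound 3F 2F = [ 3 ]
bound 1F 4F = [ 2 ]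
bound 5F 1F = [ 2 ]
bound 5F 4F = [ 3 ]
bound _  _  = ⊤⁺

label : Fin 6 → Fin 6 → Fin 4
label 1F 2F = 1F
label 0F 4F = 1F
label 3F 1F = 3F
label 5F 0F = 3F
label _  _  = 0F

Attained : Fin 6 → Fin 6 → ℕ ⁺ → Set
Attained u z ⊤⁺    = ⊤
Attained u z [ d ] = ∃[ m ] Adj u m × Adj m z × 2 ℕ.≤ d × d ℕ.≤ 5 ×
  Follows (d ∸ 1) (label u m) (label m z)

attained? : ∀ u z d → Dec (Attained u z d)
attained? u z ⊤⁺    = yes tt
attained? u z [ d ] = any? λ m → T? (adj u m) ×-dec T? (adj m z) ×-dec
  2 ℕ.≤? d ×-dec d ℕ.≤? 5 ×-dec follows? (d ∸ 1) (label u m) (label m z)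

bound-attained : ∀ u z → Attained u z (bound u z)
bound-attained = from-yes (all? λ u → all? λ z → attained? u z (bound u z))

gadget : DiTTR 4 0
gadget = record
  { tree       = doubleStar
  ; isTree     = doubleStar-isTree
  ; D          = bound
  ; D-positive = λ u v → positive (bound-attained u v)
  ; D-distance = λ u v u≢v d (_ , d≤) → distance u≢v d≤ (bound-attained u v)
  }
  where
  positive : ∀ {u v d} → Attained u v d → [ 1 ] ≤⁺ d
  positive {d = ⊤⁺}    _ = _ ≤⊤⁺
  positive {d = [ d ]} (_ , _ , _ , 2≤d , _) = [ ℕ.<⇒≤ 2≤d ]

  distance : ∀ {u v d n} → u ≢ v → (∀ (p : Path Adj u v) → n ℕ.≤ length (proj₁ p)) →
    Attained u v d → [ n + 0 ] ≤⁺ d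
  distance {d = ⊤⁺} _ _ _ = _ ≤⊤⁺
  distance {u} {v} {[ d ]} {n} u≢v n≤ (m , e , f , 2≤d , _) =
    [ subst (ℕ._≤ d) (sym (ℕ.+-identityʳ n)) (ℕ.≤-trans (n≤ path) 2≤d) ]
    where
    path : Path Adj u v
    path = e ◅ f ◅ ε ,
      ((λ { refl → adj-irrefl u e }) ∷ u≢v ∷ []) ∷ ((λ { refl → adj-irrefl v f }) ∷ []) ∷ [] ∷ []

follows-least : ∀ (i j : Fin 4) {δ₀ δ} → δ₀ ℕ.≤ 4 → 1 ℕ.≤ δ →
  Follows δ₀ i j → Follows δ i j → δ₀ ℕ.≤ δ
follows-least i j δ₀≤4 1≤δ p₀ p = ℕ.≮⇒≥ λ δ<δ₀ → distinct i j (s≤s δ₀≤4) δ<δ₀ 1≤δ p₀ p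
  where
  distinct : ∀ (i j : Fin 4) {δ₀} → δ₀ ℕ.< 5 → ∀ {δ} → δ ℕ.< δ₀ → 1 ℕ.≤ δ →
    Follows δ₀ i j → ¬ Follows δ i j
  distinct = from-yes (all? λ (i : Fin 4) → all? λ (j : Fin 4) →
    ℕ.allUpTo? (λ δ₀ → ℕ.allUpTo? (λ δ →
      1 ℕ.≤? δ →-dec follows? δ₀ i j →-dec ¬? (follows? δ i j)) δ₀) 5)

gadget-realizable : Realizable gadget
gadget-realizable = ℓ , λ u v u≢v d D≡ → valid u≢v (subst (Attained u v) D≡ (bound-attained u v))
  where
  ℓ : Labeling (DiTTR.digraph gadget) 4
  ℓ u v _ = label u v

  open TwoStep gadget ℓ

  valid : ∀ {u v d} → u ≢ v → Attained u v [ d ] →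
    Σ[ P ∈ TemporalPath ℓ u v ] (IsFastest ℓ P × duration ℓ P ℕ.≤ d)
  valid {u} {v} {suc δ₀} u≢v (m , e , f , s≤s 1≤δ₀ , s≤s δ₀≤4 , follows) =
    let P , P≡ = follows-path u≢v e f 1≤δ₀ follows
    in P , (λ Q → let _ , 1≤δ , Q≡ , follows′ = two-step-duration u≢v e f Q in
              subst₂ ℕ._≤_ (sym P≡) (sym Q≡) (s≤s (follows-least (label u m) (label m v) δ₀≤4 1≤δ follows follows′))) ,
       ℕ.≤-reflexive P≡

opposite-labels : ∀ (p q a b : Fin 4) {δ} → δ ℕ.< 3 → 1 ℕ.≤ δ → Follows 1 p a → Follows 1 b q →
  Follows δ b a → Follows 0 p q ⊎ Follows 1 p q
opposite-labels = from-yes (all? λ (p : Fin 4) → all? λ (q : Fin 4) → all? λ (a : Fin 4) →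
  all? λ (b : Fin 4) → ℕ.allUpTo? (λ δ →
  1 ℕ.≤? δ →-dec follows? 1 p a →-dec follows? 1 b q →-dec follows? δ b a →-dec
  (follows? 0 p q ⊎-dec follows? 1 p q)) 3)

follows-antisym : ∀ (p q : Fin 4) → Follows 0 p q ⊎ Follows 1 p q →
  Follows 0 q p ⊎ Follows 1 q p → p ≡ q
follows-antisym = from-yes (all? λ (p : Fin 4) → all? λ (q : Fin 4) →
  (follows? 0 p q ⊎-dec follows? 1 p q) →-dec (follows? 0 q p ⊎-dec follows? 1 q p) →-dec p ≟ q)

gadget-enforces : EnforcesEqual gadget 0F 1F _
gadget-enforces ℓ valid = follows-antisym (ℓ 0F 1F _) (ℓ 1F 0F _)
  (let _ , 1≤δ , δ≤2 , 3→2 = bounded-delay valid {3F} {1F} {2F} (λ ()) _ _ refl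
   in opposite-labels (ℓ 0F 1F _) (ℓ 1F 0F _) (ℓ 1F 2F _) (ℓ 3F 1F _) (s≤s δ≤2) 1≤δ
        (exact-delay valid {0F} {1F} {2F} (λ ()) _ _ refl)
        (exact-delay valid {3F} {1F} {0F} (λ ()) _ _ refl) 3→2)
  (let _ , 1≤δ , δ≤2 , 5→4 = bounded-delay valid {5F} {0F} {4F} (λ ()) _ _ refl
   in opposite-labels (ℓ 1F 0F _) (ℓ 0F 1F _) (ℓ 0F 4F _) (ℓ 5F 0F _) (s≤s δ≤2) 1≤δ
        (exact-delay valid {1F} {0F} {4F} (λ ()) _ _ refl)
        (exact-delay valid {5F} {0F} {1F} (λ ()) _ _ refl) 5→4)
  where open TwoStep gadget ℓ

lemma16 : Σ[ I ∈ DiTTR 4 0 ]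
    (Realizable I ×
    (Σ[ v₁ ∈ DiTTR.Vertex I ] Σ[ v₂ ∈ DiTTR.Vertex I ]
    Σ[ e ∈ DiTTR.Adj I v₁ v₂ ] EnforcesEqual I v₁ v₂ e))
lemma16 = gadget , gadget-realizable , 0F , 1F , _ , gadget-enforces
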